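{- For every $n\ge1$, the set of 1-terminal chord diagrams of size $n$ having no top cycle subdiagram equals the set of 1-terminal chord diagrams of size $n$ having neither a top cycle nor a bottom cycle subdiagram, and the cardinality of this set is the Catalan number $C_{n-1}=\frac1n\binom{2n-2}{n-1}$.
   Context: A chord diagram of size $n$ is a perfect matching of $\{1,\dots,2n\}$; chords are ordered pairs $(a,b)$ with $a<b$, $a$ the source and $b$ the sink. A subset of chords is a subdiagram, viewed as a diagram by order-preserving relabelling of endpoints. For chords $c_1=(a_1,b_1)$, $c_2=(a_2,b_2)$ with $a_1<a_2$, they cross if $a_2<b_1<b_2$, and then $c_2$ is a right neighbor of $c_1$. A chord is terminal if it has no right neighbors. A diagram is 1-terminal if no chord other than the last one, in the order of sources, is terminal. For $m\ge3$ there are exactly two diagrams whose undirected intersection graph is a cycle of length $m$ (coinciding for $m=3$): the top cycle $T_m=\{(2i-1,2i+2):1\le i\le m-1\}\cup\{(2,2m-1)\}$ and the bottom cycle $B_m=\{(2i,2i+3):1\le i\le m-2\}\cup\{(1,2m-2),(3,2m)\}$. A "top cycle (bottom cycle) subdiagram" is a subdiagram equal, after relabelling, to $T_m$ (resp. $B_m$) for some $m\ge3$. -}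

module Defs where

open import Data.Fin.Base using (Fin; toℕ; _<_; _≤_)
open import Data.Fin.Subset using (Subset; _∈_)
open import Data.Nat.Base as ℕ using (ℕ; suc; _+_; _*_; _∸_; _/_)
open import Data.Nat.Combinatorics using (_C_)
open import Data.Product.Base using (Σ; Σ-syntax; ∃-syntax; _×_; proj₁)
open import Data.Sum.Base using (_⊎_)
open import Function.Bundles using (Inverse; _⇔_)
open import Level using (0ℓ)
open import Relation.Binary.Bundles using (Setoid)
import Relation.Binary.Construct.On as On
import Relation.Binary.PropositionalEquality as ≡
open ≡ using (_≡_; _≢_)
open import Relation.Nullary.Negation.Core using (¬_)
open import Relation.Unary using (Pred)

-- A perfect matching of {1,…,2n}, given by the fixed-point-free involution
-- that sends each point to the one it is matched with.  The element x of
-- Fin (2 * n) stands for the point label x.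
record ChordDiagram (n : ℕ) : Set where
  field
    partner         : Fin (2 * n) → Fin (2 * n)
    involutive      : ∀ x → partner (partner x) ≡ x
    fixedPointFree  : ∀ x → partner x ≢ x

open ChordDiagram public using (partner)

label : ∀ {k} → Fin k → ℕ
label x = suc (toℕ x)

-- Two diagrams are equal when they match the same points; the proof fields of
-- the record play no role.
diagramSetoid : ℕ → Setoid 0ℓ 0ℓ
diagramSetoid n = record
  { Carrier       = ChordDiagram n
  ; _≈_           = λ D E → ∀ x → partner D x ≡ partner E x
  ; isEquivalence = record
    { refl  = λ _ → ≡.refl
    ; sym   = λ p x → ≡.sym (p x)
    ; trans = λ p q x → ≡.trans (p x) (q x)
    }
  }

IsChord : ∀ {n} → ChordDiagram n → Fin (2 * n) → Fin (2 * n) → Set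
IsChord D a b = a < b × partner D a ≡ b

record Chord {n : ℕ} (D : ChordDiagram n) : Set where
  field
    source   : Fin (2 * n)
    sink     : Fin (2 * n)
    isChord  : IsChord D source sink

open Chord public using (source; sink)

module _ {n : ℕ} {D : ChordDiagram n} where

  IsRightNeighbour : Chord D → Chord D → Set
  IsRightNeighbour c d =
    source c < source d × source d < sink c × sink c < sink d

  Terminal : Chord D → Set
  Terminal c = ¬ (∃[ d ] IsRightNeighbour c d)

  IsLast : Chord D → Set
  IsLast c = ∀ (d : Chord D) → source d ≤ source c

OneTerminal : ∀ {n} → Pred (ChordDiagram n) 0ℓ
OneTerminal D = ∀ (c : Chord D) → Terminal c → IsLast c

-- A subset of the chords of D, recorded by the set of all their endpoints.
record Subdiagram {n : ℕ} (D : ChordDiagram n) : Set where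
  field
    endpoints : Subset (2 * n)
    closed    : ∀ {x} → x ∈ endpoints → partner D x ∈ endpoints

-- S becomes the diagram E under the order-preserving relabelling of its
-- endpoints; position is the inverse of the relabelling, so position i is
-- the endpoint of S that is relabelled i.
record RelabelsTo {n m : ℕ} {D : ChordDiagram n}
                  (S : Subdiagram D) (E : ChordDiagram m) : Set where
  open Subdiagram S
  field
    position    : Fin (2 * m) → Fin (2 * n)
    increasing  : ∀ {i j} → i < j → position i < position j
    image       : ∀ x → x ∈ endpoints ⇔ (∃[ i ] position i ≡ x)
    sameChords  : ∀ i → partner D (position i) ≡ position (partner E i)

-- Truncated subtraction is exact below whenever m ≥ 3.
TopCycleChord : ℕ → ℕ → ℕ → Set
TopCycleChord m a b =
    (∃[ i ] 1 ℕ.≤ i × i ℕ.≤ m ∸ 1 × a ≡ 2 * i ∸ 1 × b ≡ 2 * i + 2)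
  ⊎ (a ≡ 2 × b ≡ 2 * m ∸ 1)

BottomCycleChord : ℕ → ℕ → ℕ → Set
BottomCycleChord m a b =
    (∃[ i ] 1 ℕ.≤ i × i ℕ.≤ m ∸ 2 × a ≡ 2 * i × b ≡ 2 * i + 3)
  ⊎ (a ≡ 1 × b ≡ 2 * m ∸ 2)
  ⊎ (a ≡ 3 × b ≡ 2 * m)

IsTopCycle : ∀ {m} → Pred (ChordDiagram m) 0ℓ
IsTopCycle {m} E = ∀ a b → IsChord E a b ⇔ TopCycleChord m (label a) (label b)

IsBottomCycle : ∀ {m} → Pred (ChordDiagram m) 0ℓ
IsBottomCycle {m} E =
  ∀ a b → IsChord E a b ⇔ BottomCycleChord m (label a) (label b)

HasTopCycle : ∀ {n} → Pred (ChordDiagram n) 0ℓ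
HasTopCycle D =
  ∃[ m ] 3 ℕ.≤ m ×
  Σ[ E ∈ ChordDiagram m ] IsTopCycle E × Σ[ S ∈ Subdiagram D ] RelabelsTo S E

HasBottomCycle : ∀ {n} → Pred (ChordDiagram n) 0ℓ
HasBottomCycle D =
  ∃[ m ] 3 ℕ.≤ m ×
  Σ[ E ∈ ChordDiagram m ] IsBottomCycle E × Σ[ S ∈ Subdiagram D ] RelabelsTo S E

OneTerminalTopCycleFree OneTerminalCycleFree :
  ∀ {n} → Pred (ChordDiagram n) 0ℓ
OneTerminalTopCycleFree D = OneTerminal D × ¬ HasTopCycle D
OneTerminalCycleFree D = OneTerminal D × ¬ HasTopCycle D × ¬ HasBottomCycle D

-- The set of diagrams satisfying P, taken up to equality of diagrams, has
-- exactly k elements.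
HasCardinality : ∀ {n} → Pred (ChordDiagram n) 0ℓ → ℕ → Set
HasCardinality {n} P k =
  Inverse (On.setoid {B = Σ (ChordDiagram n) P} (diagramSetoid n) proj₁)
          (≡.setoid (Fin k))

-- The division is exact.
catalan : ℕ → ℕ
catalan k = ((2 * k) C k) / suc k

{-# OPTIONS --safe #-}

-- In a 1-terminal diagram without top cycles every chord has at most one right
-- neighbour: if a chord c has two of them, d and a later one, then the greedy
-- path of right neighbours that starts at c and continues with sources after
-- that of d eventually crosses d again, and together with d it is a top cycle.
-- Conversely every top or bottom cycle contains a chord with two right
-- neighbours.
--
-- Call a 1-terminal diagram with unique right neighbours valid.  The first sink
-- of a valid diagram with at least two chords is the third of three consecutive
-- points a < s < b with a matched to b and s a source; removing the chord (a, b)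
-- leaves a valid diagram, and inserting such a chord around any source that
-- precedes the first sink is the inverse operation.  Hence the number of valid
-- diagrams of size g + k in which the points 0, …, g are sources obeys the
-- ballot recursion, and for g = 0 it is a Catalan number.
module Submission where

open import Defs
open import Data.Empty using (⊥; ⊥-elim)
open import Data.Fin.Base as Fin using (Fin; toℕ; fromℕ<)
open import Data.Fin.Induction using (>-wellFounded)
import Data.Fin.Properties as Fin
open import Data.Fin.Subset using (Subset; _∈_)
open import Data.Nat.Base
  using (ℕ; zero; suc; _+_; _*_; _/_; _≤_; _<_; _∸_; z≤n; s≤s; z<s)
open import Data.Nat.Combinatorics
  using (_C_; nC1≡n; nCk≡nC[n∸k]; nCk+nC[k+1]≡[n+1]C[k+1])
open import Data.Nat.DivMod using (m*n/n≡m)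
open import Data.Nat.Properties
open import Data.Nat.Tactic.RingSolver using (solve-∀)
open import Data.Product.Base using (_×_; _,_; proj₁; proj₂; Σ-syntax; ∃-syntax)
open import Data.Sum.Base using (_⊎_; inj₁; inj₂; [_,_]′)
open import Data.Unit.Base using (⊤; tt)
open import Data.Vec.Base using (tabulate)
open import Data.Vec.Properties using (lookup⇒[]=; []=⇒lookup; lookup∘tabulate)
open import Function.Base using (_∘_; id)
open import Function.Bundles using (_⇔_; mk⇔; Equivalence)
open import Induction.WellFounded using (Acc; acc)
open import Level using (0ℓ)
open import Relation.Binary.Definitions using (tri<; tri≈; tri>)
open import Relation.Binary.PropositionalEquality hiding (J)
open import Relation.Nullary.Decidable
  using (Dec; yes; no; does; _×-dec_; dec-true; True; toWitness)
open import Relation.Nullary.Negation.Core using (¬_)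
open import Relation.Unary using (Pred; Decidable; _≐_)

-- Chords represented by their sources

Point : ℕ → Set
Point n = Fin (2 * n)

module _ {n} (D : ChordDiagram n) where

  involutive : ∀ x → partner D (partner D x) ≡ x
  involutive = ChordDiagram.involutive D

  fixedPointFree : ∀ x → partner D x ≢ x
  fixedPointFree = ChordDiagram.fixedPointFree D

  Source : Point n → Set
  Source a = a Fin.< partner D a

  -- The inequalities force both `a` and `x` to be sources, so points can stand for chords here
  -- without separate proofs of `Source`.
  RightOf : Point n → Point n → Set
  RightOf a x = a Fin.< x × x Fin.< partner D a × partner D a Fin.< partner D x

  record Valid : Set where
    field
      unique : ∀ {a x z} → RightOf a x → RightOf a z → x ≡ z
      last   : ∀ {a} → Source a → (∀ x → ¬ RightOf a x) → ∀ {z} → Source z → z Fin.≤ a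

  -- `g` is the second parameter of the ballot recursion: it bounds the initial run of sources from
  -- below.
  ValidUpTo : ℕ → Set
  ValidUpTo g = Valid × (∀ x → toℕ x ≤ g → Source x)

  partner-injective : ∀ {x y} → partner D x ≡ partner D y → x ≡ y
  partner-injective {x} {y} e =
    trans (sym (involutive x)) (trans (cong (partner D) e) (involutive y))

  source-asym : ∀ {x} → Source x → ¬ Source (partner D x)
  source-asym {x} p q = <-asym p (subst (partner D x Fin.<_) (involutive x) q)

  ¬source⇒sink : ∀ {x} → ¬ Source x → partner D x Fin.< x
  ¬source⇒sink {x} p with <-cmp (toℕ x) (toℕ (partner D x))
  ... | tri< a _ _ = ⊥-elim (p a)

  ... | tri≈ _ b _ = ⊥-elim (fixedPointFree x (sym (Fin.toℕ-injective b)))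
  ... | tri> _ _ c = c

_≈_ : ∀ {n} → ChordDiagram n → ChordDiagram n → Set
D ≈ E = ∀ x → partner D x ≡ partner E x

partner≡⇒sym : ∀ {n} (D : ChordDiagram n) {x y} → partner D x ≡ y → partner D y ≡ x
partner≡⇒sym D {x} e = trans (cong (partner D) (sym e)) (involutive D x)

-- Inserting and removing a chord

-- The increasing enumeration of the numbers other than j and 2 + j.
skip : ℕ → ℕ → ℕ
skip zero    zero    = 1
skip zero    (suc x) = 3 + x
skip (suc j) zero    = 0
skip (suc j) (suc x) = suc (skip j x)

skip-mono-< : ∀ j {x y} → x < y → skip j x < skip j y
skip-mono-< zero    {zero}  {suc y} p       = s≤s (s≤s z≤n)
skip-mono-< zero    {suc x} {suc y} (s≤s p) = s≤s (s≤s (s≤s p))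
skip-mono-< (suc j) {zero}  {suc y} p       = z<s
skip-mono-< (suc j) {suc x} {suc y} (s≤s p) = s≤s (skip-mono-< j p)

skip-cancel-< : ∀ j {x y} → skip j x < skip j y → x < y
skip-cancel-< zero    {zero}  {zero}  (s≤s ())
skip-cancel-< zero    {zero}  {suc y} p                   = z<s
skip-cancel-< zero    {suc x} {zero}  (s≤s ())
skip-cancel-< zero    {suc x} {suc y} (s≤s (s≤s (s≤s p))) = s≤s p
skip-cancel-< (suc j) {zero}  {suc y} p                   = z<s
skip-cancel-< (suc j) {suc x} {suc y} (s≤s p)             = s≤s (skip-cancel-< j p)

skip-≤ : ∀ j x → skip j x ≤ 2 + x
skip-≤ zero    zero    = s≤s z≤n
skip-≤ zero    (suc x) = ≤-refl
skip-≤ (suc j) zero    = z≤n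
skip-≤ (suc j) (suc x) = s≤s (skip-≤ j x)

-- As `j < N`, both omitted values `j` and `2 + j` lie below `2 + N`, which leaves exactly `N`
-- values there.
skip-bound : ∀ j x {N} → j < N → skip j x < 2 + N → x < N
skip-bound zero    zero    j<N       p             = j<N
skip-bound zero    (suc x) j<N       (s≤s (s≤s p)) = p
skip-bound (suc j) zero    (s≤s j<N) p             = z<s
skip-bound (suc j) (suc x) (s≤s j<N) (s≤s p)       = s≤s (skip-bound j x j<N p)

skip-diagonal : ∀ j → skip j j ≡ suc j
skip-diagonal zero    = refl
skip-diagonal (suc j) = cong suc (skip-diagonal j)

skip≢j : ∀ j x → skip j x ≢ j
skip≢j zero    zero    ()
skip≢j zero    (suc x) ()
skip≢j (suc j) (suc x) = skip≢j j x ∘ suc-injective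

skip≢2+j : ∀ j x → skip j x ≢ 2 + j
skip≢2+j zero    zero    ()
skip≢2+j zero    (suc x) ()
skip≢2+j (suc j) (suc x) = skip≢2+j j x ∘ suc-injective

skip-cover : ∀ j y → y ≡ j ⊎ y ≡ 2 + j ⊎ (∃[ x ] y ≡ skip j x)
skip-cover zero    zero                = inj₁ refl
skip-cover zero    (suc zero)          = inj₂ (inj₂ (0 , refl))
skip-cover zero    (suc (suc zero))    = inj₂ (inj₁ refl)
skip-cover zero    (suc (suc (suc y))) = inj₂ (inj₂ (suc y , refl))
skip-cover (suc j) zero                = inj₂ (inj₂ (0 , refl))
skip-cover (suc j) (suc y) with skip-cover j y
... | inj₁ p              = inj₁ (cong suc p)
... | inj₂ (inj₁ p)       = inj₂ (inj₁ (cong suc p))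
... | inj₂ (inj₂ (x , p)) = inj₂ (inj₂ (suc x , cong suc p))

module Insertion (n j : ℕ) (j<2n : j < 2 * n) where

  j<2+2n : j < 2 * suc n
  j<2+2n = subst (j <_) (sym (*-suc 2 n)) (m<n⇒m<1+n (m<n⇒m<1+n j<2n))

  2+j<2+2n : 2 + j < 2 * suc n
  2+j<2+2n = subst (2 + j <_) (sym (*-suc 2 n)) (s≤s (s≤s j<2n))

  α β : Point (suc n)
  α = fromℕ< j<2+2n
  β = fromℕ< 2+j<2+2n

  ι-bound : ∀ (x : Point n) → skip j (toℕ x) < 2 * suc n
  ι-bound x = subst (skip j (toℕ x) <_) (sym (*-suc 2 n))
                (≤-<-trans (skip-≤ j (toℕ x)) (s≤s (s≤s (Fin.toℕ<n x))))

  ι : Point n → Point (suc n)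
  ι x = fromℕ< (ι-bound x)

  toℕ-α : toℕ α ≡ j
  toℕ-α = Fin.toℕ-fromℕ< j<2+2n

  toℕ-β : toℕ β ≡ 2 + j
  toℕ-β = Fin.toℕ-fromℕ< 2+j<2+2n

  toℕ-ι : ∀ x → toℕ (ι x) ≡ skip j (toℕ x)
  toℕ-ι x = Fin.toℕ-fromℕ< (ι-bound x)

  data View : Point (suc n) → Set where
    isα : View α
    isβ : View β
    isι : ∀ x → View (ι x)

  view : ∀ y → View y
  view y with skip-cover j (toℕ y)
  ... | inj₁ e        = subst View (Fin.toℕ-injective (trans toℕ-α (sym e))) isα
  ... | inj₂ (inj₁ e) = subst View (Fin.toℕ-injective (trans toℕ-β (sym e))) isβ
  ... | inj₂ (inj₂ (x , e)) =
    subst View (Fin.toℕ-injective (trans (toℕ-ι x′)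
                 (trans (cong (skip j) (Fin.toℕ-fromℕ< x<2n)) (sym e))))
          (isι x′)
    where
    x<2n = skip-bound j x j<2n (subst₂ _<_ e (*-suc 2 n) (Fin.toℕ<n y))
    x′   = fromℕ< x<2n

  ι-mono-< : ∀ {x y} → x Fin.< y → ι x Fin.< ι y
  ι-mono-< {x} {y} p = subst₂ _<_ (sym (toℕ-ι x)) (sym (toℕ-ι y)) (skip-mono-< j p)

  ι-cancel-< : ∀ {x y} → ι x Fin.< ι y → x Fin.< y
  ι-cancel-< {x} {y} p = skip-cancel-< j (subst₂ _<_ (toℕ-ι x) (toℕ-ι y) p)

  ι-injective : ∀ {x y} → ι x ≡ ι y → x ≡ y
  ι-injective {x} {y} e with Fin.<-cmp x y
  ... | tri< p _ _ = ⊥-elim (<-irrefl (cong toℕ e) (ι-mono-< p))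

  ... | tri≈ _ p _ = p
  ... | tri> _ _ p = ⊥-elim (<-irrefl (cong toℕ (sym e)) (ι-mono-< p))

  ι≢α : ∀ {x} → ι x ≢ α
  ι≢α {x} e = skip≢j j (toℕ x) (trans (sym (toℕ-ι x)) (trans (cong toℕ e) toℕ-α))

  ι≢β : ∀ {x} → ι x ≢ β
  ι≢β {x} e = skip≢2+j j (toℕ x) (trans (sym (toℕ-ι x)) (trans (cong toℕ e) toℕ-β))

  α<β : α Fin.< β
  α<β = subst₂ _<_ (sym toℕ-α) (sym toℕ-β) (s≤s (n≤1+n j))

  -- A relation rather than a function, so that the same lemmas serve insertion and removal.
  record Extends (D : ChordDiagram n) (E : ChordDiagram (suc n)) : Set where
    field
      new : partner E α ≡ β
      old : ∀ x → partner E (ι x) ≡ ι (partner D x)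

    new′ : partner E β ≡ α
    new′ = trans (cong (partner E) (sym new)) (involutive E α)

  open Extends

  insert : ∀ D → Σ[ E ∈ ChordDiagram (suc n) ] Extends D E
  insert D = record { partner = λ y → to (view y)
                    ; involutive = λ y → inv y (view y)
                    ; fixedPointFree = λ y → fpf (view y) }
           , record { new = to-α (view α) refl ; old = λ x → to-ι x (view (ι x)) refl }
    where
    to : ∀ {y} → View y → Point (suc n)
    to isα     = β
    to isβ     = α
    to (isι x) = ι (partner D x)

    -- `view α` does not reduce to `isα`, so `to` is evaluated at an arbitrary view of a point equal
    -- to `α`; likewise for `β` and `ι x`.
    to-α : ∀ {y} (v : View y) → y ≡ α → to v ≡ β
    to-α isα     _ = refl
    to-α isβ     e = ⊥-elim (<-irrefl (cong toℕ (sym e)) α<β)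
    to-α (isι x) e = ⊥-elim (ι≢α e)

    to-β : ∀ {y} (v : View y) → y ≡ β → to v ≡ α
    to-β isα     e = ⊥-elim (<-irrefl (cong toℕ e) α<β)
    to-β isβ     _ = refl
    to-β (isι x) e = ⊥-elim (ι≢β e)

    to-ι : ∀ x {y} (v : View y) → y ≡ ι x → to v ≡ ι (partner D x)
    to-ι x isα     e = ⊥-elim (ι≢α (sym e))
    to-ι x isβ     e = ⊥-elim (ι≢β (sym e))
    to-ι x (isι z) e = cong (ι ∘ partner D) (ι-injective e)

    inv : ∀ y (v : View y) → to (view (to v)) ≡ y
    inv _ isα     = to-β (view β) refl
    inv _ isβ     = to-α (view α) refl
    inv _ (isι x) = trans (to-ι (partner D x) (view _) refl) (cong ι (involutive D x))

    fpf : ∀ {y} (v : View y) → to v ≢ y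
    fpf isα     e = <-irrefl (cong toℕ (sym e)) α<β
    fpf isβ     e = <-irrefl (cong toℕ e) α<β
    fpf (isι x) e = fixedPointFree D x (ι-injective e)

  -- `α` and `β` are matched to each other, so `partner E` maps the image of `ι` to itself;
  -- injectivity of `ι` transfers the laws of a matching.
  remove : ∀ (E : ChordDiagram (suc n)) → partner E α ≡ β →
           Σ[ D ∈ ChordDiagram n ] Extends D E
  remove E e = record { partner = proj₁ ∘ from ; involutive = inv ; fixedPointFree = fpf }
             , record { new = e ; old = proj₂ ∘ from }
    where
    e′ : partner E β ≡ α
    e′ = trans (cong (partner E) (sym e)) (involutive E α)

    from′ : ∀ x {y} → partner E (ι x) ≡ y → View y → ∃[ z ] partner E (ι x) ≡ ι z
    from′ x p isα     = ⊥-elim (ι≢β (partner-injective E (trans p (sym e′))))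
    from′ x p isβ     = ⊥-elim (ι≢α (partner-injective E (trans p (sym e))))
    from′ x p (isι z) = z , p

    from : ∀ x → ∃[ z ] partner E (ι x) ≡ ι z
    from x = from′ x refl (view _)

    inv : ∀ x → proj₁ (from (proj₁ (from x))) ≡ x
    inv x = ι-injective (trans (sym (proj₂ (from (proj₁ (from x)))))
              (trans (cong (partner E) (sym (proj₂ (from x)))) (involutive E (ι x))))

    fpf : ∀ x → proj₁ (from x) ≢ x
    fpf x p = fixedPointFree E (ι x) (trans (proj₂ (from x)) (cong ι p))

  module _ {D D′ : ChordDiagram n} {E E′ : ChordDiagram (suc n)}
           (X : Extends D E) (X′ : Extends D′ E′) where

    extends-cong : D ≈ D′ → E ≈ E′
    extends-cong p y = go (view y)
      where
      go : ∀ {y} → View y → partner E y ≡ partner E′ y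
      go isα     = trans (new X) (sym (new X′))
      go isβ     = trans (new′ X) (sym (new′ X′))
      go (isι x) = trans (old X x) (trans (cong ι (p x)) (sym (old X′ x)))

    extends-injective : E ≈ E′ → D ≈ D′
    extends-injective p x = ι-injective (trans (sym (old X x)) (trans (p (ι x)) (old X′ x)))

  -- The one old point enclosed by the new chord: `ι J` sits at `1 + j`, between `α` and `β`.
  J : Point n
  J = fromℕ< j<2n

  toℕ-J : toℕ J ≡ j
  toℕ-J = Fin.toℕ-fromℕ< j<2n

  toℕ-ιJ : toℕ (ι J) ≡ suc j
  toℕ-ιJ = trans (toℕ-ι J) (trans (cong (skip j) toℕ-J) (skip-diagonal j))

  between-αβ : ∀ {y} → α Fin.< y → y Fin.< β → y ≡ ι J
  between-αβ {y} p q = Fin.toℕ-injective (trans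
    (≤-antisym (≤-pred (subst (toℕ y <_) toℕ-β q)) (subst (_< toℕ y) toℕ-α p)) (sym toℕ-ιJ))

  α<ιJ : α Fin.< ι J
  α<ιJ = subst₂ _<_ (sym toℕ-α) (sym toℕ-ιJ) ≤-refl

  ιJ<β : ι J Fin.< β
  ιJ<β = subst₂ _<_ (sym toℕ-ιJ) (sym toℕ-β) ≤-refl

  ι-mono-≤ : ∀ {x y} → x Fin.≤ y → ι x Fin.≤ ι y
  ι-mono-≤ p = ≮⇒≥ λ q → <⇒≱ (ι-cancel-< q) p

  ι-cancel-≤ : ∀ {x y} → ι x Fin.≤ ι y → x Fin.≤ y
  ι-cancel-≤ p = ≮⇒≥ λ q → <⇒≱ (ι-mono-< q) p

  module _ {D : ChordDiagram n} {E : ChordDiagram (suc n)} (X : Extends D E)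
           (J-source : Source D J) where

    β-sink : partner E β Fin.< β
    β-sink = subst (Fin._< β) (sym (new′ X)) α<β

    ι-source : ∀ {x} → Source D x → Source E (ι x)
    ι-source {x} p = subst (ι x Fin.<_) (sym (old X x)) (ι-mono-< p)

    ι-source⁻¹ : ∀ {x} → Source E (ι x) → Source D x
    ι-source⁻¹ {x} p = ι-cancel-< (subst (ι x Fin.<_) (old X x) p)

    ι-rightOf : ∀ {a x} → RightOf D a x → RightOf E (ι a) (ι x)
    ι-rightOf {a} {x} (p , q , r) =
      ι-mono-< p , subst (ι x Fin.<_) (sym (old X a)) (ι-mono-< q) ,
      subst₂ Fin._<_ (sym (old X a)) (sym (old X x)) (ι-mono-< r)

    ι-rightOf⁻¹ : ∀ {a x} → RightOf E (ι a) (ι x) → RightOf D a x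
    ι-rightOf⁻¹ {a} {x} (p , q , r) =
      ι-cancel-< p , ι-cancel-< (subst (ι x Fin.<_) (old X a) q) ,
      ι-cancel-< (subst₂ Fin._<_ (old X a) (old X x) r)

    rightOf-α : ∀ {y} → RightOf E α y → y ≡ ι J
    rightOf-α {y} (p , q , _) = between-αβ p (subst (y Fin.<_) (new X) q)

    α-rightOf : RightOf E α (ι J)
    α-rightOf = α<ιJ , subst (ι J Fin.<_) (sym (new X)) ιJ<β ,
      subst (Fin._< partner E (ι J)) (sym (new X)) β<
      where
      β< : β Fin.< partner E (ι J)
      -- The partner of `ι J` lies past `1 + j`, hence at `β` or later, and it is an old point,
      -- hence not `β`.
      β< = ≤∧≢⇒< (subst₂ _≤_ (trans (cong suc toℕ-ιJ) (sym toℕ-β)) refl (ι-source J-source))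
                 (λ e → ι≢β (trans (sym (old X J)) (sym (Fin.toℕ-injective e))))

    ¬β-source : ¬ Source E β
    ¬β-source p = <-asym p β-sink

    ¬rightOf-β : ∀ {y} → ¬ RightOf E β y
    ¬rightOf-β (p , q , _) = ¬β-source (<-trans p q)

    ¬β-rightOf : ∀ {a} → ¬ RightOf E a β
    ¬β-rightOf (_ , q , r) = ¬β-source (<-trans q r)

    -- Otherwise the sink of `ι a` would lie strictly between `α` and `β`, that is at `ι J`, which
    -- is a source.
    ¬α-rightOf : ∀ {a} → ¬ RightOf E (ι a) α
    ¬α-rightOf {a} (p , q , r) = source-asym E (<-trans p q)
      (subst (Source E) (sym (between-αβ q (subst (partner E (ι a) Fin.<_) (new X) r)))
        (ι-source J-source))

    -- Right neighbours among old chords are unchanged. The new chord has `ι J` as its only right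
    -- neighbour and is a right neighbour of no chord.
    extends-valid : Valid D → Valid E
    extends-valid V = record
      { unique = λ {a} {x} {z} → uniq (view a) (view x) (view z)
      ; last   = λ {a} p t {z} → lst (view a) p t (view z)
      }
      where
      open Valid V
      uniq : ∀ {a x z} → View a → View x → View z → RightOf E a x → RightOf E a z → x ≡ z
      uniq isα     _       _       p q = trans (rightOf-α p) (sym (rightOf-α q))
      uniq isβ     _       _       p q = ⊥-elim (¬rightOf-β p)
      uniq (isι a) isα     _       p q = ⊥-elim (¬α-rightOf p)
      uniq (isι a) isβ     _       p q = ⊥-elim (¬β-rightOf p)
      uniq (isι a) (isι x) isα     p q = ⊥-elim (¬α-rightOf q)
      uniq (isι a) (isι x) isβ     p q = ⊥-elim (¬β-rightOf q)
      uniq (isι a) (isι x) (isι z) p q = cong ι (unique (ι-rightOf⁻¹ p) (ι-rightOf⁻¹ q))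

      lst : ∀ {a z} → View a → Source E a → (∀ x → ¬ RightOf E a x) → View z →
            Source E z → z Fin.≤ a
      lst isα     p t _ q = ⊥-elim (t (ι J) α-rightOf)
      lst isβ     p t _ q = ⊥-elim (¬β-source p)
      lst (isι a) p t v q with last (ι-source⁻¹ p) (λ x → t (ι x) ∘ ι-rightOf) | v
      -- `J` is a source of `D`, so it does not exceed the last source `a`, and `α` precedes `ι J`.
      ... | l | isα   = <⇒≤ (<-≤-trans α<ιJ (ι-mono-≤ (l J-source)))
      ... | l | isβ   = ⊥-elim (¬β-source q)
      ... | l | isι z = ι-mono-≤ (l (ι-source⁻¹ q))

    extends-valid⁻¹ : Valid E → Valid D
    extends-valid⁻¹ V = record
      { unique = λ p q → ι-injective (unique (ι-rightOf p) (ι-rightOf q))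
      ; last   = λ {a} p t q → ι-cancel-≤ (last (ι-source p) (λ x → term t (view x)) (ι-source q))
      }
      where
      open Valid V
      term : ∀ {a x} → (∀ x → ¬ RightOf D a x) → View x → ¬ RightOf E (ι a) x
      term t isα     = ¬α-rightOf
      term t isβ     = ¬β-rightOf
      term t (isι x) = t x ∘ ι-rightOf⁻¹

  module _ {D : ChordDiagram n} {E : ChordDiagram (suc n)} (X : Extends D E) where

    -- The points up to `1 + j` are `α` and the images of the points up to `j`; the next point is
    -- the sink `β`.
    extends-validUpTo : ValidUpTo D j → ValidUpTo E (suc j) × ¬ Source E β
    extends-validUpTo (V , s) =
      (extends-valid X J-src V , λ x → src (view x)) , ¬β-source X J-src
      where
      J-src : Source D J
      J-src = s J (≤-reflexive toℕ-J)

      src : ∀ {x} → View x → toℕ x ≤ suc j → Source E x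
      src isα     p = subst (α Fin.<_) (sym (new X)) α<β
      src isβ     p = ⊥-elim (<⇒≱ ≤-refl (subst (_≤ suc j) toℕ-β p))
      src (isι x) p = ι-source X J-src (s x (subst (toℕ x ≤_) toℕ-J
        (ι-cancel-≤ (subst (toℕ (ι x) ≤_) (sym toℕ-ιJ) p))))

    extends-validUpTo⁻¹ : ValidUpTo E (suc j) → ValidUpTo D j
    extends-validUpTo⁻¹ (V , s) =
      extends-valid⁻¹ X (src J (≤-reflexive toℕ-J)) V , src
      where
      src : ∀ x → toℕ x ≤ j → Source D x
      src x p = ι-cancel-< (subst (ι x Fin.<_) (old X x) (s (ι x)
        (subst (toℕ (ι x) ≤_) toℕ-ιJ (ι-mono-≤ (subst (toℕ x ≤_) (sym toℕ-J) p)))))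

-- Counting valid diagrams

-- All points before `b` are sources, so every point strictly between `a` and `b` starts a chord
-- ending after `b`, which makes it a right neighbour of `a`. Uniqueness allows at most one such
-- point; if there were none, `a` would be terminal, and the position of the last chord would be
-- contradicted.
first-sink : ∀ {n g} (D : ChordDiagram n) → 2 ≤ n → ValidUpTo D g →
             ∀ b → toℕ b ≡ suc g → ¬ Source D b →
             ∃[ j ] g ≡ suc j × toℕ (partner D b) ≡ j
first-sink {n} {g} D 2≤n (V , s) b b≡ ¬b = cases (m≤n⇒∃[o]m+o≡n a≤g)
  where
  open Valid V
  a : Point n
  a = partner D b

  a<b : a Fin.< b
  a<b = ¬source⇒sink D ¬b

  πa : partner D a ≡ b
  πa = involutive D b

  a≤g : toℕ a ≤ g
  a≤g = ≤-pred (subst (toℕ a <_) b≡ a<b)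

  below : ∀ {x} → x Fin.< b → Source D x
  below {x} p = s x (≤-pred (subst (toℕ x <_) b≡ p))

  b<π : ∀ {x} → x Fin.< b → x ≢ a → b Fin.< partner D x
  b<π {x} p x≢a with Fin.<-cmp (partner D x) b
  ... | tri< q _ _ = ⊥-elim (source-asym D (below p) (below q))
  ... | tri≈ _ q _ = ⊥-elim (x≢a (sym (partner≡⇒sym D q)))
  ... | tri> _ _ q = q

  a-rightOf : ∀ {x} → a Fin.< x → x Fin.< b → RightOf D a x
  a-rightOf {x} p q = p , subst (x Fin.<_) (sym πa) q ,
    subst (Fin._< partner D x) (sym πa) (b<π q λ e → <-irrefl (cong toℕ (sym e)) p)

  b<2n : suc g < 2 * n
  b<2n = subst (_< 2 * n) b≡ (Fin.toℕ<n b)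

  -- `o` is the number of points strictly between `a` and `b`, since `b` is at `suc g`.
  cases : (∃[ o ] toℕ a + o ≡ g) → ∃[ j ] g ≡ suc j × toℕ a ≡ j
  cases (suc zero , e) = toℕ a , trans (sym e) (+-comm (toℕ a) 1) , refl
  -- The points `1 + a` and `2 + a` would be two right neighbours of `a`.
  cases (suc (suc o) , e) = ⊥-elim (<-irrefl x≡y ≤-refl)
    where
    2+a≤g : 2 + toℕ a ≤ g
    2+a≤g = subst (2 + toℕ a ≤_) (trans (sym (+-comm (toℕ a) (2 + o))) e)
              (s≤s (s≤s (m≤n+m (toℕ a) o)))

    rn : ∀ i → toℕ a < i → i ≤ g → ∃[ x ] toℕ x ≡ i × RightOf D a x
    rn i p q = fromℕ< i<2n , i≡ ,
      a-rightOf (subst (toℕ a <_) (sym i≡) p) (subst₂ _<_ (sym i≡) (sym b≡) (s≤s q))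
      where
      i<2n : i < 2 * n
      i<2n = <-trans (s≤s q) b<2n
      i≡ = Fin.toℕ-fromℕ< i<2n

    X = rn (1 + toℕ a) ≤-refl (<⇒≤ 2+a≤g)
    Y = rn (2 + toℕ a) (n≤1+n _) 2+a≤g

    x≡y : 1 + toℕ a ≡ 2 + toℕ a
    x≡y = trans (sym (proj₁ (proj₂ X)))
            (trans (cong toℕ (unique (proj₂ (proj₂ X)) (proj₂ (proj₂ Y)))) (proj₁ (proj₂ Y)))
  -- Now `b` directly follows `a`, so `a` is terminal and therefore the last source.
  cases (zero , e) = ⊥-elim (absurd (toℕ a) refl)
    where
    a≡g : toℕ a ≡ g
    a≡g = trans (sym (+-identityʳ _)) e

    b≡1+a : toℕ b ≡ suc (toℕ a)
    b≡1+a = trans b≡ (cong suc (sym a≡g))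

    last-a : ∀ {z} → Source D z → z Fin.≤ a
    last-a = last (below a<b) λ x (p , q , _) →
      <⇒≱ p (≤-pred (subst (toℕ x <_) (trans (cong toℕ πa) b≡1+a) q))

    absurd : ∀ i → toℕ a ≡ i → ⊥
    -- The chord is (0, 1). As `2 ≤ n`, there is a point 2; it comes after the last source, yet as a
    -- sink it could only be matched to 0 or 1.
    absurd zero a≡0 = c-sink (toℕ (partner D c)) refl
      where
      2<2n : 2 < 2 * n
      2<2n = ≤-trans (n≤1+n 3) (*-monoʳ-≤ 2 2≤n)
      c = fromℕ< 2<2n
      c≡2 : toℕ c ≡ 2
      c≡2 = Fin.toℕ-fromℕ< 2<2n
      b≡1 : toℕ b ≡ 1
      b≡1 = trans b≡1+a (cong suc a≡0)
      ¬c : ¬ Source D c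
      ¬c p with () ← subst₂ _≤_ c≡2 a≡0 (last-a p)

      c-sink : ∀ i → toℕ (partner D c) ≡ i → ⊥
      c-sink zero q = 2≢1 (trans (sym c≡2) (trans (cong toℕ c≡b) b≡1))
        where
        2≢1 : 2 ≢ 1
        2≢1 ()
        c≡b = trans (sym (partner≡⇒sym D (Fin.toℕ-injective (trans q (sym a≡0))))) πa
      c-sink (suc zero) q = 2≢0 (trans (sym c≡2) (trans (cong toℕ c≡a) a≡0))
        where
        2≢0 : 2 ≢ 0
        2≢0 ()
        c≡a = sym (partner≡⇒sym D (Fin.toℕ-injective (trans q (sym b≡1))))
      c-sink (suc (suc i)) q = <⇒≱ (subst₂ _<_ q c≡2 (¬source⇒sink D ¬c)) (s≤s (s≤s z≤n))
    -- The point `z` just before `a` is also terminal: its only candidate for a right neighbour is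
    -- the last source `a`, whose chord ends at `b`, before that of `z`. So `z` would be last too.
    absurd (suc i) a≡ = <⇒≱ z<a (last (below z<b) term (below a<b))
      where
      i<2n : i < 2 * n
      i<2n = <-trans (subst (i <_) (sym a≡) ≤-refl) (Fin.toℕ<n a)
      z = fromℕ< i<2n
      z≡i : toℕ z ≡ i
      z≡i = Fin.toℕ-fromℕ< i<2n
      z<a : z Fin.< a
      z<a = subst₂ _<_ (sym z≡i) (sym a≡) ≤-refl
      z<b = <-trans z<a a<b
      term : ∀ x → ¬ RightOf D z x
      term x (p , q , r) = <-asym (b<π z<b λ e → <-irrefl (cong toℕ e) z<a)
        (subst (partner D z Fin.<_) (trans (cong (partner D) x≡a) πa) r)
        where
        x≡a : x ≡ a
        x≡a = Fin.toℕ-injective (≤-antisym (last-a (<-trans q r))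
                (subst (_≤ toℕ x) (trans (cong suc z≡i) (sym a≡)) p))

-- Pigeonhole: the `n + 1` sources `0, …, n` would need distinct partners among the `n` points from
-- `n` on.
¬validUpTo-all : ∀ {g} (D : ChordDiagram (suc g)) → ¬ ValidUpTo D (suc g)
¬validUpTo-all {g} D (V , s) = conclude (Fin.pigeonhole {n} {suc n} ≤-refl f)
  where
  n = suc g

  point< : ∀ (i : Fin (suc n)) → toℕ i < 2 * n
  point< i = ≤-trans (Fin.toℕ<n i) (s≤s (subst (n ≤_) (sym (+-suc g _)) (s≤s (m≤m+n g _))))

  point : Fin (suc n) → Point n
  point i = fromℕ< (point< i)

  source-point : ∀ i → Source D (point i)
  source-point i = s (point i)
    (subst (_≤ n) (sym (Fin.toℕ-fromℕ< (point< i))) (≤-pred (Fin.toℕ<n i)))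

  n≤partner : ∀ i → n ≤ toℕ (partner D (point i))
  n≤partner i = ≮⇒≥ λ p → source-asym D (source-point i) (s _ (<⇒≤ p))

  f< : ∀ i → toℕ (partner D (point i)) ∸ n < n
  f< i = m<n+o⇒m∸n<o _ n (subst (toℕ (partner D (point i)) <_)
    (cong (n +_) (+-identityʳ n)) (Fin.toℕ<n _))

  f : Fin (suc n) → Fin n
  f i = fromℕ< (f< i)

  conclude : ¬ (∃[ i ] ∃[ j ] i Fin.< j × f i ≡ f j)
  conclude (i , j , i<j , e) = <-irrefl i≡j i<j
    where
    i≡j : toℕ i ≡ toℕ j
    i≡j = Fin.fromℕ<-injective _ _ (point< i) (point< j) (partner-injective D
      (Fin.toℕ-injective (∸-cancelʳ-≡ (n≤partner i) (n≤partner j)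
        (Fin.fromℕ<-injective _ _ (f< i) (f< j) e))))

-- Enumerations up to equality of diagrams, and the ballot recursion

record Enumeration {n} (P : Pred (ChordDiagram n) 0ℓ) (k : ℕ) : Set where
  field
    diagram    : Fin k → ChordDiagram n
    satisfies  : ∀ i → P (diagram i)
    injective  : ∀ {i j} → diagram i ≈ diagram j → i ≡ j
    surjective : ∀ D → P D → ∃[ i ] D ≈ diagram i

enumeration⇒hasCardinality : ∀ {n} {P : Pred (ChordDiagram n) 0ℓ} {k} →
                             Enumeration P k → HasCardinality P k
enumeration⇒hasCardinality e = record
  { to        = λ (D , p) → proj₁ (surjective D p)
  ; from      = λ i → diagram i , satisfies i
  ; to-cong   = λ { {D , p} {E , q} D≈E → injective λ x →
      trans (sym (proj₂ (surjective D p) x)) (trans (D≈E x) (proj₂ (surjective E q) x)) }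
  ; from-cong = λ { refl x → refl }
  ; inverse   = (λ { {i} {D , p} D≈ → injective λ x →
                  trans (sym (proj₂ (surjective D p) x)) (D≈ x) })
              , (λ { {D , p} refl x → sym (proj₂ (surjective D p) x) })
  }
  where open Enumeration e

enumeration-≐ : ∀ {n} {P Q : Pred (ChordDiagram n) 0ℓ} {k} →
                P ≐ Q → Enumeration P k → Enumeration Q k
enumeration-≐ (P⇒Q , Q⇒P) e = record
  { diagram    = diagram
  ; satisfies  = P⇒Q ∘ satisfies
  ; injective  = injective
  ; surjective = λ D → surjective D ∘ Q⇒P
  }
  where open Enumeration e

enumeration-∅ : ∀ {n} {P : Pred (ChordDiagram n) 0ℓ} → (∀ D → ¬ P D) → Enumeration P 0
enumeration-∅ ¬P = record
  { diagram = λ () ; satisfies = λ () ; injective = λ { {()} }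
  ; surjective = λ D p → ⊥-elim (¬P D p) }

-- Disjointness is required up to `≈`, because the concatenated listing has to be injective up to
-- `≈`.
enumeration-⊎ : ∀ {n} {P Q R : Pred (ChordDiagram n) 0ℓ} {k l} →
                Enumeration Q k → Enumeration R l →
                (∀ {D} → P D → Q D ⊎ R D) → (∀ {D} → Q D ⊎ R D → P D) →
                (∀ {D E} → D ≈ E → Q D → ¬ R E) → Enumeration P (k + l)
enumeration-⊎ {n} {P} {Q} {R} {k} {l} e f split merge disjoint = record
  { diagram    = diag ∘ Fin.splitAt k
  ; satisfies  = sat ∘ Fin.splitAt k
  ; injective  = λ {i} {j} p → trans (sym (Fin.join-splitAt k l i))
      (trans (cong (Fin.join k l) (inj (Fin.splitAt k i) (Fin.splitAt k j) p))
        (Fin.join-splitAt k l j))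
  ; surjective = λ D p → surj D (split p)
  }
  where
  module Q = Enumeration e
  module R = Enumeration f
  diag : Fin k ⊎ Fin l → ChordDiagram n
  diag = [ Q.diagram , R.diagram ]′

  sat : ∀ i → P (diag i)
  sat (inj₁ i) = merge (inj₁ (Q.satisfies i))
  sat (inj₂ i) = merge (inj₂ (R.satisfies i))

  inj : ∀ i j → diag i ≈ diag j → i ≡ j
  inj (inj₁ i) (inj₁ j) p = cong inj₁ (Q.injective p)
  inj (inj₁ i) (inj₂ j) p = ⊥-elim (disjoint p (Q.satisfies i) (R.satisfies j))
  inj (inj₂ i) (inj₁ j) p = ⊥-elim (disjoint (λ x → sym (p x)) (Q.satisfies j) (R.satisfies i))
  inj (inj₂ i) (inj₂ j) p = cong inj₂ (R.injective p)

  surj′ : ∀ D i → D ≈ diag i → ∃[ i ] D ≈ diag (Fin.splitAt k i)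
  surj′ D i p = Fin.join k l i , λ x → trans (p x)
    (cong (λ z → partner (diag z) x) (sym (Fin.splitAt-join k l i)))

  surj : ∀ D → Q D ⊎ R D → ∃[ i ] D ≈ diag (Fin.splitAt k i)
  surj D (inj₁ q) = surj′ D (inj₁ (proj₁ (Q.surjective D q))) (proj₂ (Q.surjective D q))
  surj D (inj₂ r) = surj′ D (inj₂ (proj₁ (R.surjective D r))) (proj₂ (R.surjective D r))

-- The number of valid diagrams of size g + k in which the points 0, …, g are
-- sources (for g + k ≥ 1); the summands for suc k and suc g are the cases of the
-- point 2 + g being a sink or a source.
ballot : ℕ → ℕ → ℕ
ballot zero          g       = 0
ballot (suc k)       (suc g) = ballot (suc k) g + ballot k (2 + g)
ballot (suc zero)    zero    = 1
ballot (suc (suc k)) zero    = ballot (suc k) 1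

-- Quantifying over the points numbered `i` avoids carrying a bound on `i`; out of range the
-- condition is vacuous.
SinkAt : ∀ {n} → ℕ → Pred (ChordDiagram n) 0ℓ
SinkAt i D = ∀ x → toℕ x ≡ i → ¬ Source D x

-- The sink at `2 + g` is the first one, so `first-sink` matches it to the point `g`. Removing that
-- chord inverts the insertion at `j = g`.
enumeration-insert : ∀ {n g k} → g < 2 * n → Enumeration {n} (λ D → ValidUpTo D g) k →
  Enumeration {suc n} (λ E → ValidUpTo E (suc g) × SinkAt (2 + g) E) k
enumeration-insert {n} {g} g<2n e = record
  { diagram    = λ i → proj₁ (insert (diagram i))
  ; satisfies  = λ i → let V , ¬β = extends-validUpTo (proj₂ (insert (diagram i))) (satisfies i)
      in V , λ x x≡ → subst (¬_ ∘ Source (proj₁ (insert (diagram i))))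
           (Fin.toℕ-injective (trans toℕ-β (sym x≡))) ¬β
  ; injective  = λ {i} {j} p → injective
      (extends-injective (proj₂ (insert (diagram i))) (proj₂ (insert (diagram j))) p)
  ; surjective = surj
  }
  where
  open Enumeration e
  open Insertion n g g<2n
  surj : ∀ E → ValidUpTo E (suc g) × SinkAt (2 + g) E →
         ∃[ i ] E ≈ proj₁ (insert (diagram i))
  surj E (V , sink) = let i , D≈ = surjective D (extends-validUpTo⁻¹ X V)
                      in i , extends-cong X (proj₂ (insert (diagram i))) D≈
    where
    1≤n : ∀ {n} → g < 2 * n → 1 ≤ n
    1≤n {suc n} _ = z<s

    πβ : partner E β ≡ α
    πβ with first-sink E (s≤s (1≤n g<2n)) V β toℕ-β (sink β toℕ-β)
    ... | _ , refl , e = Fin.toℕ-injective (trans e (sym toℕ-α))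

    D = proj₁ (remove E (partner≡⇒sym E πβ))
    X = proj₂ (remove E (partner≡⇒sym E πβ))

enumeration-step : ∀ {n g k l} → g < 2 * n → Enumeration {n} (λ D → ValidUpTo D g) k →
  Enumeration {suc n} (λ E → ValidUpTo E (2 + g)) l →
  Enumeration {suc n} (λ E → ValidUpTo E (suc g)) (k + l)
enumeration-step {n} {g} g<2n e f = enumeration-⊎ (enumeration-insert g<2n e) f split merge disjoint
  where
  open Insertion n g g<2n using (β; toℕ-β)

  split : ∀ {E} → ValidUpTo E (suc g) →
          (ValidUpTo E (suc g) × SinkAt (2 + g) E) ⊎ ValidUpTo E (2 + g)
  split {E} (V , s) with toℕ β <? toℕ (partner E β)
  ... | yes p = inj₂ (V , s′)
    where
    s′ : ∀ x → toℕ x ≤ 2 + g → Source E x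
    s′ x q with m≤n⇒m<n∨m≡n q
    ... | inj₁ r = s x (≤-pred r)
    ... | inj₂ r = subst (Source E) (Fin.toℕ-injective (trans toℕ-β (sym r))) p
  ... | no ¬p = inj₁ ((V , s) , λ x r →
    subst (¬_ ∘ Source E) (Fin.toℕ-injective (trans toℕ-β (sym r))) ¬p)

  merge : ∀ {E} → (ValidUpTo E (suc g) × SinkAt (2 + g) E) ⊎ ValidUpTo E (2 + g) →
          ValidUpTo E (suc g)
  merge (inj₁ (V , _)) = V
  merge (inj₂ (V , s)) = V , λ x p → s x (m≤n⇒m≤1+n p)

  disjoint : ∀ {E F} → E ≈ F → ValidUpTo E (suc g) × SinkAt (2 + g) E → ¬ ValidUpTo F (2 + g)
  disjoint p (_ , b) (_ , s) = b β toℕ-β (subst (β Fin.<_) (sym (p β)) (s β (≤-reflexive toℕ-β)))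

source-zero : ∀ {n} (D : ChordDiagram n) x → toℕ x ≡ 0 → Source D x
source-zero D x e = ≤∧≢⇒< (subst (_≤ toℕ (partner D x)) (sym e) z≤n)
  (λ q → fixedPointFree D x (sym (Fin.toℕ-injective q)))

-- If the point 1 were a sink, `first-sink` would place its partner one before the point 0.
enumeration-start : ∀ {k n} → 2 ≤ n → Enumeration {n} (λ D → ValidUpTo D 1) k →
                    Enumeration {n} (λ D → ValidUpTo D 0) k
enumeration-start {k} {n} 2≤n = enumeration-≐ (proj , ext)
  where
  proj : ∀ {D} → ValidUpTo D 1 → ValidUpTo D 0
  proj (V , s) = V , λ x p → s x (m≤n⇒m≤1+n p)

  ext : ∀ {D} → ValidUpTo D 0 → ValidUpTo D 1
  ext {D} (V , s) = V , s′
    where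
    s′ : ∀ x → toℕ x ≤ 1 → Source D x
    s′ x p with m≤n⇒m<n∨m≡n p | toℕ x <? toℕ (partner D x)
    ... | inj₁ q | _     = s x (≤-pred q)
    ... | inj₂ q | yes r = r
    ... | inj₂ q | no ¬r with first-sink D 2≤n (V , s) x q ¬r
    ... | _ , () , _

enumeration-single : Enumeration {1} (λ D → ValidUpTo D 0) 1
enumeration-single = record
  { diagram    = λ _ → D₁
  ; satisfies  = λ _ → valid , λ x p → source-zero D₁ x (n≤0⇒n≡0 p)
  ; injective  = λ { {Fin.zero} {Fin.zero} _ → refl }
  ; surjective = λ D _ → Fin.zero , unique D
  }
  where
  D₁ : ChordDiagram 1
  D₁ = record
    { partner        = λ { Fin.zero → Fin.suc Fin.zero ; (Fin.suc Fin.zero) → Fin.zero }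
    ; involutive     = λ { Fin.zero → refl ; (Fin.suc Fin.zero) → refl }
    ; fixedPointFree = λ { Fin.zero () ; (Fin.suc Fin.zero) () }
    }

  valid : Valid D₁
  valid = record
    { unique = λ { {Fin.zero} {Fin.zero} (() , _) _
                 ; {Fin.zero} {Fin.suc Fin.zero} (_ , s≤s () , _) _
                 ; {Fin.suc Fin.zero} (_ , () , _) _ }
    ; last   = λ { {Fin.zero} _ _ {Fin.zero} _ → z≤n
                 ; {Fin.zero} _ _ {Fin.suc Fin.zero} ()
                 ; {Fin.suc Fin.zero} () }
    }

  unique : ∀ D → D ≈ D₁
  unique D Fin.zero with partner D Fin.zero in e
  ... | Fin.zero = ⊥-elim (fixedPointFree D _ e)
  ... | Fin.suc Fin.zero = refl
  unique D (Fin.suc Fin.zero) with partner D (Fin.suc Fin.zero) in e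
  ... | Fin.zero = refl
  ... | Fin.suc Fin.zero = ⊥-elim (fixedPointFree D _ e)

-- The clauses follow those of `ballot`. For `k = 0` there would be more sources than chords.
enumeration : ∀ k g n → n ≡ g + k → 1 ≤ n → Enumeration {n} (λ D → ValidUpTo D g) (ballot k g)
-- Size 0 must be excluded: the empty diagram is vacuously valid, while `ballot 0 0` is 0.
enumeration zero zero .0 refl ()
enumeration zero (suc g) n e _ rewrite trans e (+-identityʳ (suc g)) =
  enumeration-∅ ¬validUpTo-all
enumeration (suc zero) zero .1 refl _ = enumeration-single
enumeration (suc (suc k)) zero n e 1≤n =
  enumeration-start (subst (2 ≤_) (sym e) (s≤s (s≤s z≤n))) (enumeration (suc k) 1 n e 1≤n)
enumeration (suc k) (suc g) (suc n) e _ = enumeration-step g<2n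
  (enumeration (suc k) g n n≡ (≤-trans (s≤s z≤n) g<n))
  (enumeration k (2 + g) (suc n) (trans e (cong suc (+-suc g k))) (s≤s z≤n))
  where
  n≡ : n ≡ g + suc k
  n≡ = suc-injective e
  g<n : g < n
  g<n = subst (g <_) (sym n≡) (m<m+n g (s≤s z≤n))
  g<2n : g < 2 * n
  g<2n = <-≤-trans g<n (m≤m+n n _)

-- Ballot numbers, binomial coefficients and Catalan numbers

pascal : ∀ n k → suc n C suc k ≡ n C k + n C suc k
pascal n k = sym (nCk+nC[k+1]≡[n+1]C[k+1] n k)

-- The identity (k+1) C(n, k+1) = (n-k) C(n, k) without subtraction, by induction along Pascal's
-- rule.
absorption : ∀ n k → suc k * (n C suc k) + k * (n C k) ≡ n * (n C k)
absorption zero    zero    = refl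
absorption zero    (suc k) = cong₂ _+_ (*-zeroʳ (2 + k)) (*-zeroʳ (suc k))
absorption (suc n) zero    = trans (+-identityʳ _) (trans (+-identityʳ _)
                               (trans (nC1≡n (suc n)) (sym (*-identityʳ (suc n)))))
absorption (suc n) (suc k) = begin
  (2 + k) * (suc n C (2 + k)) + suc k * (suc n C suc k)
    ≡⟨ cong₂ (λ x y → (2 + k) * x + suc k * y) (pascal n (suc k)) (pascal n k) ⟩
  (2 + k) * (c₁ + c₂) + suc k * (c₀ + c₁)
    ≡⟨ regroup k c₀ c₁ c₂ ⟩
  ((2 + k) * c₂ + suc k * c₁) + (suc k * c₁ + k * c₀) + (c₀ + c₁)
    ≡⟨ cong₂ (λ x y → x + y + (c₀ + c₁)) (absorption n (suc k)) (absorption n k) ⟩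
  n * c₁ + n * c₀ + (c₀ + c₁)
    ≡⟨ collect n c₀ c₁ ⟩
  suc n * (c₀ + c₁)
    ≡⟨ cong (suc n *_) (pascal n k) ⟨
  suc n * (suc n C suc k) ∎
  where
  open ≡-Reasoning
  c₀ = n C k
  c₁ = n C suc k
  c₂ = n C (2 + k)
  regroup : ∀ k a b c → (2 + k) * (b + c) + suc k * (a + b) ≡
                        ((2 + k) * c + suc k * b) + (suc k * b + k * a) + (a + b)
  regroup = solve-∀
  collect : ∀ n a b → n * b + n * a + (a + b) ≡ suc n * (a + b)
  collect = solve-∀

ballot-1 : ∀ g → ballot 1 g ≡ 1
ballot-1 zero    = refl
ballot-1 (suc g) = trans (+-identityʳ _) (ballot-1 g)

-- The reflection-principle formula for ballot numbers, stated additively.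
ballot-C : ∀ k g {N} → N ≡ 2 + (k + k + g) → ballot (2 + k) g + N C k ≡ N C suc k
ballot-C zero zero refl = refl
ballot-C (suc k) zero {suc N} e = begin
  b + suc N C suc k              ≡⟨ cong (b +_) (pascal N k) ⟩
  b + (N C k + N C suc k)        ≡⟨ +-assoc b _ _ ⟨
  b + N C k + N C suc k          ≡⟨ cong (_+ N C suc k) (ballot-C k 1 N≡) ⟩
  N C suc k + N C suc k          ≡⟨ cong (N C suc k +_) middle ⟩
  N C suc k + N C (2 + k)        ≡⟨ pascal N (suc k) ⟨
  suc N C (2 + k)                ∎
  where
  open ≡-Reasoning
  b = ballot (2 + k) 1
  N≡ : N ≡ 2 + (k + k + 1)
  N≡ = trans (suc-injective e) (shift k)
    where
    shift : ∀ k → 1 + (suc k + suc k + 0) ≡ 2 + (k + k + 1)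
    shift = solve-∀
  N≡′ : N ≡ (1 + k) + (2 + k)
  N≡′ = trans N≡ (shift k)
    where
    shift : ∀ k → 2 + (k + k + 1) ≡ (1 + k) + (2 + k)
    shift = solve-∀
  -- `N` is odd and these are its two central binomial coefficients, equal by symmetry.
  middle : N C suc k ≡ N C (2 + k)
  middle rewrite N≡′ = trans (nCk≡nC[n∸k] (m≤m+n (1 + k) (2 + k)))
                             (cong ((1 + k + (2 + k)) C_) (m+n∸m≡n (1 + k) (2 + k)))
-- The recursion reaches `ballot 1`, which is outside the range of the formula but is constantly 1.
ballot-C zero (suc g) {suc N} e = begin
  ballot 2 g + ballot 1 (2 + g) + 1  ≡⟨ cong (λ x → ballot 2 g + x + 1) (ballot-1 (2 + g)) ⟩
  ballot 2 g + 1 + 1                 ≡⟨ cong (_+ 1) (ballot-C zero g (suc-injective e)) ⟩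
  N C 1 + 1                          ≡⟨ +-comm (N C 1) 1 ⟩
  1 + N C 1                          ≡⟨ pascal N 0 ⟨
  suc N C 1                          ∎
  where open ≡-Reasoning
ballot-C (suc k) (suc g) {suc N} e = begin
  b₁ + b₂ + suc N C suc k                ≡⟨ cong (b₁ + b₂ +_) (pascal N k) ⟩
  b₁ + b₂ + (N C k + N C suc k)          ≡⟨ regroup b₁ b₂ _ _ ⟩
  (b₂ + N C k) + (b₁ + N C suc k)
    ≡⟨ cong₂ _+_ (ballot-C k (2 + g) N≡) (ballot-C (suc k) g N≡′) ⟩
  N C suc k + N C (2 + k)                ≡⟨ pascal N (suc k) ⟨
  suc N C (2 + k)                        ∎
  where
  open ≡-Reasoning
  b₁ = ballot (3 + k) g
  b₂ = ballot (2 + k) (2 + g)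
  N≡′ : N ≡ 2 + (suc k + suc k + g)
  N≡′ = trans (suc-injective e) (cong suc (+-suc (suc k + suc k) g))
  N≡ : N ≡ 2 + (k + k + (2 + g))
  N≡ = trans N≡′ (shift k g)
    where
    shift : ∀ k g → 2 + (suc k + suc k + g) ≡ 2 + (k + k + (2 + g))
    shift = solve-∀
  regroup : ∀ a b c d → a + b + (c + d) ≡ (b + c) + (a + d)
  regroup = solve-∀

-- The ballot formula gives `b = X - Y` and absorption gives `(k + 1) X = (k + 2) Y`. Together they
-- yield `(k + 2) b = X`, so the division is exact.
ballot≡catalan : ∀ k → ballot (suc k) 0 ≡ catalan k
ballot≡catalan zero    = refl
ballot≡catalan (suc k) = sym (trans (cong (_/ (2 + k)) (sym b*≡)) (m*n/n≡m b (2 + k)))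
  where
  open ≡-Reasoning
  N = 2 * suc k
  b = ballot (2 + k) 0
  X = N C suc k
  Y = N C k
  N≡ : ∀ k → 2 * suc k ≡ 2 + (k + k + 0)
  N≡ = solve-∀
  b+Y≡X : b + Y ≡ X
  b+Y≡X = ballot-C k 0 (N≡ k)
  expand : ∀ k y → 2 * suc k * y ≡ (2 + k) * y + k * y
  expand = solve-∀
  X≡Y : suc k * X ≡ (2 + k) * Y
  X≡Y = +-cancelʳ-≡ (k * Y) _ _ (trans (absorption N k) (expand k Y))
  expand′ : ∀ k x → (2 + k) * x ≡ x + suc k * x
  expand′ = solve-∀
  b*≡ : b * (2 + k) ≡ X
  b*≡ = +-cancelʳ-≡ (suc k * X) _ _ (begin
    b * (2 + k) + suc k * X      ≡⟨ cong₂ _+_ (*-comm b (2 + k)) X≡Y ⟩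
    (2 + k) * b + (2 + k) * Y    ≡⟨ *-distribˡ-+ (2 + k) b Y ⟨
    (2 + k) * (b + Y)            ≡⟨ cong ((2 + k) *_) b+Y≡X ⟩
    (2 + k) * X                  ≡⟨ expand′ k X ⟩
    X + suc k * X                ∎)

-- Top and bottom cycles

LastIfTerminal : ∀ {n} → Pred (ChordDiagram n) 0ℓ
LastIfTerminal D =
  ∀ {a} → Source D a → (∀ x → ¬ RightOf D a x) → ∀ {z} → Source D z → z Fin.≤ a

module _ {n} {D : ChordDiagram n} where

  sink≡ : (c : Chord D) → partner D (source c) ≡ sink c
  sink≡ c = proj₂ (Chord.isChord c)

  chord-source : (c : Chord D) → Source D (source c)
  chord-source c = subst (source c Fin.<_) (sym (sink≡ c)) (proj₁ (Chord.isChord c))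

  chordAt : ∀ {a} → Source D a → Chord D
  chordAt {a} p = record { source = a ; sink = partner D a ; isChord = p , refl }

  oneTerminal⇒lastIfTerminal : OneTerminal D → LastIfTerminal D
  oneTerminal⇒lastIfTerminal one {a} p t q = one (chordAt p)
    (λ (d , r , s , u) → t (source d) (r , s , subst (partner D a Fin.<_) (sym (sink≡ d)) u))
    (chordAt q)

  lastIfTerminal⇒oneTerminal : LastIfTerminal D → OneTerminal D
  lastIfTerminal⇒oneTerminal last c t d = last (chord-source c)
    (λ x (p , q , r) → t (chordAt (<-trans q r) , p ,
      subst (x Fin.<_) (sink≡ c) q , subst (Fin._< partner D x) (sink≡ c) r))
    (chord-source d)

  module _ {m} {E : ChordDiagram m} {S : Subdiagram D} (R : RelabelsTo S E) where
    open RelabelsTo R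

    position-rightOf : ∀ {a x} → RightOf E a x → RightOf D (position a) (position x)
    position-rightOf {a} {x} (p , q , r) = increasing p ,
      subst (position x Fin.<_) (sym (sameChords a)) (increasing q) ,
      subst₂ Fin._<_ (sym (sameChords a)) (sym (sameChords x)) (increasing r)

    position-injective : ∀ {x z} → position x ≡ position z → x ≡ z
    position-injective {x} {z} e with Fin.<-cmp x z
    ... | tri< p _ _ = ⊥-elim (<-irrefl (cong toℕ e) (increasing p))
    ... | tri≈ _ p _ = p
    ... | tri> _ _ p = ⊥-elim (<-irrefl (cong toℕ (sym e)) (increasing p))

    -- Relabelling preserves order and partners, so uniqueness of right neighbours passes to
    -- subdiagrams.
    unique-rightOf : Valid D → ∀ {a x z} → RightOf E a x → RightOf E a z → x ≡ z
    unique-rightOf V p q =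
      position-injective (Valid.unique V (position-rightOf p) (position-rightOf q))

-- `IsC` stands for the chord predicate of either cycle. Points count from 0 and labels from 1,
-- hence the `suc`s.
module Numbered {m} (E : ChordDiagram m) (IsC : ℕ → ℕ → Set)
                (isC : ∀ a b → IsChord E a b ⇔ IsC (label a) (label b)) where

  point : ∀ {i} → i < 2 * m → Point m
  point p = fromℕ< p

  partner-point : ∀ {i j} (p : i < 2 * m) (q : j < 2 * m) → IsC (suc i) (suc j) →
                  partner E (point p) ≡ point q
  partner-point {i} {j} p q c = proj₂ (Equivalence.from (isC (point p) (point q))
    (subst₂ IsC (cong suc (sym (Fin.toℕ-fromℕ< p))) (cong suc (sym (Fin.toℕ-fromℕ< q))) c))

  rightOf-point : ∀ {a b x y} (p : a < 2 * m) (q : b < 2 * m) (r : x < 2 * m) (s : y < 2 * m) →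
                  IsC (suc a) (suc b) → IsC (suc x) (suc y) → a < x → x < b → b < y →
                  RightOf E (point p) (point r)
  rightOf-point p q r s c d a<x x<b b<y
    rewrite partner-point p q c | partner-point r s d
          | Fin.toℕ-fromℕ< p | Fin.toℕ-fromℕ< q | Fin.toℕ-fromℕ< r | Fin.toℕ-fromℕ< s
    = a<x , x<b , b<y

-- In T_m, with labels from 1, the chord (1, 4) has the two right neighbours (2, 2m-1) and (3, 6).
valid⇒¬top : ∀ {n} {D : ChordDiagram n} → Valid D → ¬ HasTopCycle D
valid⇒¬top V (suc (suc (suc k)) , s≤s (s≤s (s≤s z≤n)) , E , isTop , S , R) =
  1≢2 (Fin.fromℕ<-injective 1 2 (lt 1) (lt 2) (unique-rightOf R V
    (rightOf-point (lt 0) (lt 3) (lt 1) last<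
      (inj₁ (1 , s≤s z≤n , s≤s z≤n , refl , refl)) (inj₂ (refl , eq k))
      (s≤s z≤n) (s≤s (s≤s z≤n)) (s≤s (s≤s (s≤s (s≤s z≤n)))))
    (rightOf-point (lt 0) (lt 3) (lt 2) (lt 5)
      (inj₁ (1 , s≤s z≤n , s≤s z≤n , refl , refl))
      (inj₁ (2 , s≤s z≤n , s≤s (s≤s z≤n) , refl , refl))
      (s≤s z≤n) (s≤s (s≤s (s≤s z≤n))) (s≤s (s≤s (s≤s (s≤s z≤n)))))))
  where
  open Numbered E (TopCycleChord (3 + k)) isTop
  double : ∀ k → 6 + (k + k) ≡ 2 * (3 + k)
  double = solve-∀

  bound : ∀ {i} → i < 6 + (k + k) → i < 2 * (3 + k)
  bound {i} = subst (i <_) (double k)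

  lt : ∀ i {_ : True (i <? 6)} → i < 2 * (3 + k)
  lt i {t} = bound (≤-trans (toWitness t) (m≤m+n 6 _))

  last< : 4 + (k + k) < 2 * (3 + k)
  last< = bound (n≤1+n _)

  eq : ∀ k → 5 + (k + k) ≡ 2 * (3 + k) ∸ 1
  eq k = cong (_∸ 1) (double k)

  1≢2 : 1 ≢ 2
  1≢2 ()

-- In B_m, with labels from 1, the chord (1, 2m-2) has the right neighbours (3, 2m) and (2m-4,
-- 2m-1); their sources differ in parity.
valid⇒¬bottom : ∀ {n} {D : ChordDiagram n} → Valid D → ¬ HasBottomCycle D
valid⇒¬bottom V (suc (suc (suc k)) , s≤s (s≤s (s≤s z≤n)) , E , isBottom , S , R) =
  2≢ k (Fin.fromℕ<-injective 2 (suc (k + k)) two< x< (unique-rightOf R V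
    (rightOf-point zero< b< two< (bound ≤-refl) first third
      (s≤s z≤n) (s≤s (s≤s (s≤s z≤n))) (s≤s (n≤1+n _)))
    (rightOf-point zero< b< x< (bound (n≤1+n _)) first long
      (s≤s z≤n) (s≤s (s≤s (n≤1+n _))) ≤-refl)))
  where
  open Numbered E (BottomCycleChord (3 + k)) isBottom
  double : ∀ k → 6 + (k + k) ≡ 2 * (3 + k)
  double = solve-∀

  bound : ∀ {i} → i < 6 + (k + k) → i < 2 * (3 + k)
  bound {i} = subst (i <_) (double k)

  zero< : 0 < 2 * (3 + k)
  zero< = bound (s≤s z≤n)
  two< : 2 < 2 * (3 + k)
  two< = bound (s≤s (s≤s (s≤s z≤n)))
  x< : suc (k + k) < 2 * (3 + k)
  x< = bound (m<n+m _ {5} z<s)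
  b< : 3 + (k + k) < 2 * (3 + k)
  b< = bound (m<n+m _ {3} z<s)

  first : BottomCycleChord (3 + k) 1 (4 + (k + k))
  first = inj₂ (inj₁ (refl , cong (_∸ 2) (double k)))

  third : BottomCycleChord (3 + k) 3 (6 + (k + k))
  third = inj₂ (inj₂ (refl , double k))

  long : BottomCycleChord (3 + k) (2 + (k + k)) (5 + (k + k))
  long = inj₁ (suc k , s≤s z≤n , ≤-refl , eq k , eq′ k)
    where
    eq : ∀ k → 2 + (k + k) ≡ 2 * suc k
    eq = solve-∀
    eq′ : ∀ k → 5 + (k + k) ≡ 2 * suc k + 3
    eq′ = solve-∀

  2≢ : ∀ k → 2 ≢ suc (k + k)
  2≢ zero ()
  2≢ (suc k) e with () ← trans (suc-injective (suc-injective e)) (+-suc k k)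

-- Top cycles as closed zigzags

-- Unlike `2 * suc k`, `double (suc k)` unfolds to two successors in front, matching the two points
-- that each `step` of a `Zigzag` adds.
double : ℕ → ℕ
double zero    = 0
double (suc k) = 2 + double k

double≡2* : ∀ k → double k ≡ 2 * k
double≡2* zero    = refl
double≡2* (suc k) = trans (cong (2 +_) (double≡2* k)) (sym (*-suc 2 k))

double-mono-≤ : ∀ {k l} → k ≤ l → double k ≤ double l
double-mono-≤ z≤n     = z≤n
double-mono-≤ (s≤s p) = s≤s (s≤s (double-mono-≤ p))

double-cancel-< : ∀ {k l} → double k < double l → k < l
double-cancel-< p = ≰⇒> λ q → <⇒≱ p (double-mono-≤ q)

data Parity : ℕ → Set where
  even : ∀ q → Parity (double q)
  odd  : ∀ q → Parity (suc (double q))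

parity : ∀ i → Parity i
parity zero = even 0
parity (suc i) with parity i
... | even q = odd q
... | odd q  = even (suc q)

-- The chords of the top cycle T_m, with points numbered from 0.
data Link : ℕ → ℕ → ℕ → Set where
  along  : ∀ {m} q → suc q < m → Link m (double q) (3 + double q)
  around : ∀ k → Link (suc k) 1 (double k)

-- The bound on `m` matters: `around 0` runs backwards, from 1 to 0.
link-< : ∀ {m i j} → 2 ≤ m → Link m i j → i < j
link-< _             (along q _)        = s≤s (m≤n+m (double q) 2)
link-< (s≤s (s≤s _)) (around (suc k)) = s≤s (s≤s z≤n)

link⇒top : ∀ {m i j} → Link m i j → TopCycleChord m (suc i) (suc j)
link⇒top (along q (s≤s p)) = inj₁ (suc q , s≤s z≤n , p , cong (_∸ 1) (double≡2* (suc q)) ,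
  trans (cong (2 +_) (double≡2* (suc q))) (+-comm 2 (2 * suc q)))
link⇒top (around k) = inj₂ (refl , cong (_∸ 1) (double≡2* (suc k)))

top⇒link : ∀ {m i j} → 1 ≤ m → TopCycleChord m (suc i) (suc j) → Link m i j
top⇒link {suc m} _ (inj₁ (suc q , _ , p , e , f)) = subst₂ (Link (suc m))
  (suc-injective (trans (cong (_∸ 1) (double≡2* (suc q))) (sym e)))
  (suc-injective (trans (cong (2 +_) (double≡2* (suc q))) (trans (+-comm 2 (2 * suc q)) (sym f))))
  (along q (s≤s p))
top⇒link {suc m} _ (inj₂ (refl , f)) = subst (Link (suc m) 1)
  (suc-injective (trans (cong (_∸ 1) (double≡2* (suc m))) (sym f))) (around m)

-- Even points start an `along` link, except the last one, which `around` joins to the point 1; the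
-- other odd points end an `along` link.
linked : ∀ m i → i < double m → ∃[ j ] j < double m × (Link m i j ⊎ Link m j i)
linked (suc m) i i< with parity i
... | odd zero = double m , n≤1+n _ , inj₁ (around m)
... | odd (suc q) = double q , ≤-trans (s≤s (m≤n+m (double q) 3)) i< ,
  inj₂ (along q (double-cancel-< (<-trans (n<1+n _) i<)))
... | even q with m≤n⇒m<n∨m≡n (double-cancel-< {q} {suc m} i<)
...   | inj₁ p    = 3 + double q , double-mono-≤ p , inj₁ (along q p)
...   | inj₂ refl = 1 , s≤s (s≤s z≤n) , inj₂ (around q)

module _ {n} (D : ChordDiagram n) where

  -- The points s = S₀ < t = T₀ < S₁ < T₁ < … < Sₖ₋₁ < Tₖ₋₁ with Sᵢ matched to
  -- Tᵢ₊₁ and the last Sₖ₋₁ matched to x.  For x = t this is a top cycle.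
  data Zigzag (x : Point n) : Point n → Point n → ℕ → Set where
    close : ∀ {s t} → s Fin.< t → partner D s ≡ x → Zigzag x s t 1
    step  : ∀ {s t s′ k} → s Fin.< t → t Fin.< s′ → Zigzag x s′ (partner D s) k →
            Zigzag x s t (suc k)

  at : ∀ {x s t k} → Zigzag x s t k → ℕ → Point n
  at {s = s} z            zero          = s
  at {t = t} z            (suc zero)    = t
  at         (step _ _ z) (suc (suc i)) = at z i
  -- A default value past the end: `close` contributes only the points 0 and 1.
  at {s = s} (close _ _)  (suc (suc i)) = s

  at-suc : ∀ {x s t k} (z : Zigzag x s t k) i → suc i < double k → at z i Fin.< at z (suc i)
  at-suc (close p _)  zero          _             = p
  at-suc (close p _)  (suc i)       (s≤s (s≤s ()))
  at-suc (step p _ _) zero          _             = p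
  at-suc (step _ q _) (suc zero)    _             = q
  at-suc (step _ _ z) (suc (suc i)) (s≤s (s≤s p)) = at-suc z i p

  at-mono : ∀ {x s t k} (z : Zigzag x s t k) {i j} → i < j → j < double k → at z i Fin.< at z j
  at-mono z {i} {suc j} (s≤s i≤j) j< with m≤n⇒m<n∨m≡n i≤j
  ... | inj₁ i<j  = <-trans (at-mono z i<j (<-trans (n<1+n j) j<)) (at-suc z j j<)
  ... | inj₂ refl = at-suc z i j<

  partner-along : ∀ {x s t k} (z : Zigzag x s t k) q → suc q < k →
                  partner D (at z (double q)) ≡ at z (3 + double q)
  partner-along (close _ _)  q       (s≤s ())
  partner-along (step _ _ z) zero    _       = refl
  partner-along (step _ _ z) (suc q) (s≤s p) = partner-along z q p

  partner-around : ∀ {x s t k} (z : Zigzag x s t (suc k)) → partner D (at z (double k)) ≡ x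
  partner-around (close _ e)              = e
  partner-around {k = suc k} (step _ _ z) = partner-around z

  module Closed {x s m} (z : Zigzag x s x m) (3≤m : 3 ≤ m) where

    bound : ∀ (i : Point m) → toℕ i < double m
    bound i = subst (toℕ i <_) (sym (double≡2* m)) (Fin.toℕ<n i)

    position : Point m → Point n
    position i = at z (toℕ i)

    increasing : ∀ {i j} → i Fin.< j → position i Fin.< position j
    increasing {j = j} p = at-mono z p (bound j)

    position-inj : ∀ {i j} → position i ≡ position j → i ≡ j
    position-inj {i} {j} e with Fin.<-cmp i j
    ... | tri< p _ _ = ⊥-elim (<-irrefl (cong toℕ e) (increasing p))
    ... | tri≈ _ p _ = p
    ... | tri> _ _ p = ⊥-elim (<-irrefl (cong toℕ (sym e)) (increasing p))

    partner-link : ∀ {m i j} (z : Zigzag x s x m) → Link m i j → partner D (at z i) ≡ at z j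
    partner-link z (along q p) = partner-along z q p
    partner-link z (around k)  = partner≡⇒sym D (partner-around z)

    mate′ : ∀ i → ∃[ j ] (Link m (toℕ i) (toℕ j) ⊎ Link m (toℕ j) (toℕ i))
    mate′ i with linked m (toℕ i) (bound i)
    ... | j , j< , l = fromℕ< j<′ ,
      subst (λ j → Link m (toℕ i) j ⊎ Link m j (toℕ i)) (sym (Fin.toℕ-fromℕ< j<′)) l
      where
      j<′ : j < 2 * m
      j<′ = subst (j <_) (double≡2* m) j<

    mate : Point m → Point m
    mate = proj₁ ∘ mate′

    same : ∀ i → partner D (position i) ≡ position (mate i)
    same i = [ partner-link z , partner≡⇒sym D ∘ partner-link z ]′ (proj₂ (mate′ i))

    -- `position` is injective and carries `mate` to `partner D`, so `mate` inherits the laws of a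
    -- matching.
    cycle : ChordDiagram m
    cycle = record
      { partner        = mate
      ; involutive     = λ i → position-inj (trans (sym (same (mate i)))
                           (trans (cong (partner D) (sym (same i))) (involutive D _)))
      ; fixedPointFree = λ i e → fixedPointFree D _ (trans (same i) (cong position e))
      }

    2≤m : 2 ≤ m
    2≤m = ≤-trans (n≤1+n 2) 3≤m

    isTop : IsTopCycle cycle
    isTop a b = mk⇔ to from
      where
      to : IsChord cycle a b → TopCycleChord m (label a) (label b)
      to (a<b , refl) =
        [ link⇒top , (λ l → ⊥-elim (<-asym a<b (link-< 2≤m l))) ]′ (proj₂ (mate′ a))

      from : TopCycleChord m (label a) (label b) → IsChord cycle a b
      from t = link-< 2≤m l , position-inj (trans (sym (same a)) (partner-link z l))
        where
        l = top⇒link (≤-trans (n≤1+n 1) 2≤m) t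

    hit? : ∀ y → Dec (∃[ i ] position i ≡ y)
    hit? y = Fin.any? λ i → position i Fin.≟ y

    endpoints : Subset (2 * n)
    endpoints = tabulate (does ∘ hit?)

    image : ∀ y → y ∈ endpoints ⇔ (∃[ i ] position i ≡ y)
    image y = mk⇔ to from
      where
      to : y ∈ endpoints → ∃[ i ] position i ≡ y
      to p with hit? y | trans (sym (lookup∘tabulate (does ∘ hit?) y)) ([]=⇒lookup p)
      ... | yes h | _ = h
      ... | no _  | ()
      from : (∃[ i ] position i ≡ y) → y ∈ endpoints
      from h = lookup⇒[]= y endpoints
        (trans (lookup∘tabulate (does ∘ hit?) y) (dec-true (hit? y) h))

    hasTop : HasTopCycle D
    hasTop = m , 3≤m , cycle , isTop
      , record { endpoints = endpoints
               ; closed = λ {y} p → let i , e = Equivalence.to (image y) p in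
                   Equivalence.from (image (partner D y))
                     (mate i , trans (sym (same i)) (cong (partner D) e)) }
      , record { position = position ; increasing = increasing
               ; image = image ; sameChords = same }

  rightOf? : ∀ a x → Dec (RightOf D a x)
  rightOf? a x = a Fin.<? x ×-dec x Fin.<? partner D a ×-dec partner D a Fin.<? partner D x

-- A top cycle from two right neighbours

argmax : ∀ {N M} (f : Fin N → Fin M) {P : Pred (Fin N) 0ℓ} → Decidable P → ∀ w → P w →
         ∃[ w ] P w × (∀ v → P v → f v Fin.≤ f w)
argmax f {P} P? w pw = go w pw (>-wellFounded (f w))
  where
  go : ∀ w → P w → Acc Fin._>_ (f w) → ∃[ w ] P w × (∀ v → P v → f v Fin.≤ f w)
  go w pw (acc rs) with Fin.any? (λ v → P? v ×-dec f w Fin.<? f v)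
  ... | yes (v , pv , lt) = go v pv (rs lt)
  ... | no ¬v             = w , pw , λ v pv → ≮⇒≥ λ lt → ¬v (v , pv , lt)

module _ {n} (D : ChordDiagram n) (last : LastIfTerminal D) where

  -- The chord ending at the largest point `T` is terminal, as no chord ends later. Two terminal
  -- chords are both last, so `w` is its source.
  terminal-sink-max : ∀ {w} → Source D w → (∀ x → ¬ RightOf D w x) → ∀ v → v Fin.≤ partner D w
  terminal-sink-max {w} p t v = subst (v Fin.≤_) (sym πw≡T) (T-max v tt)
    where
    top = argmax id {λ _ → ⊤} (λ _ → yes tt) w tt
    T = proj₁ top
    T-max = proj₂ (proj₂ top)
    L = partner D T

    L-source : Source D L
    L-source = subst (L Fin.<_) (sym (involutive D T))
                 (¬source⇒sink D λ q → <⇒≱ q (T-max _ tt))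

    L-terminal : ∀ x → ¬ RightOf D L x
    L-terminal x (_ , _ , r) =
      <⇒≱ (subst (Fin._< partner D x) (involutive D T) r) (T-max _ tt)

    w≡L : w ≡ L
    w≡L = Fin.toℕ-injective (≤-antisym (last L-source L-terminal p) (last p t L-source))

    πw≡T : partner D w ≡ T
    πw≡T = trans (cong (partner D) w≡L) (involutive D T)

  -- Repeatedly move to the right neighbour that reaches furthest to the right:
  -- by this choice no chord of the path crosses the one after the next.
  zigzag : ∀ x s t → s Fin.< t → t Fin.< partner D s → partner D s Fin.< partner D x →
           (∀ v → x Fin.< v → RightOf D s v → t Fin.< v) →
           (∃[ v ] x Fin.< v × RightOf D s v) → Acc Fin._>_ (partner D s) →
           ∃[ k ] Zigzag D x s t (3 + k)
  zigzag x s t s<t t<πs πs<y sep (v , x<v , rv) (acc rs)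
    with argmax (partner D) (λ v → x Fin.<? v ×-dec rightOf? D s v) v (x<v , rv)
  ... | w , (x<w , rw@(s<w , w<πs , πs<πw)) , maxw with Fin.<-cmp (partner D w) (partner D x)
  -- The chord of `w` now crosses that of `x`, whose sink becomes the final point matched to `x`.
  ...   | tri> _ _ y<πw = 0 , step s<t (sep w x<w rw)
            (step w<πs πs<y (close y<πw (involutive D x)))
  ...   | tri≈ _ e _ = ⊥-elim (<-irrefl (cong toℕ (sym (partner-injective D e))) x<w)
  ...   | tri< πw<y _ _ with Fin.any? (rightOf? D w)
  -- A terminal `w` would end at the largest point, but `partner D x` lies beyond its sink.
  ...     | no t = ⊥-elim (<⇒≱ πw<y
            (terminal-sink-max (<-trans w<πs πs<πw) (λ x r → t (x , r)) _))
  ...     | yes (u , w<u , ru) = let k , z = zigzag x w (partner D s) w<πs πs<πw πw<y sep′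
                                               (u , <-trans x<w w<u , w<u , ru) (rs πs<πw)
                                 in suc k , step s<t (sep w x<w rw) z
    where
    s-source : Source D s
    s-source = <-trans s<t t<πs

    -- A right neighbour `v` of `w` before the sink of `s` would also be one of `s` and reach
    -- further than `w`, contrary to the choice of `w`.
    sep′ : ∀ v → x Fin.< v → RightOf D w v → partner D s Fin.< v
    sep′ v x<v (w<v , v<πw , πw<πv) with Fin.<-cmp (partner D s) v
    ... | tri< p _ _    = p
    ... | tri≈ _ refl _ = ⊥-elim (source-asym D s-source (<-trans v<πw πw<πv))
    ... | tri> _ _ v<πs = ⊥-elim (<⇒≱ πw<πv (maxw v (x<v ,
                            <-trans s<w w<v , v<πs , <-trans πs<πw πw<πv)))

  -- The path starts at `a` with `x` itself as second point, so the zigzag closes up; the separation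
  -- condition is then immediate.
  two-rightOf⇒top : ∀ {a x z} → RightOf D a x → RightOf D a z → x Fin.< z → HasTopCycle D
  two-rightOf⇒top {a} {x} {z} (a<x , x<πa , πa<πx) r x<z =
    Closed.hasTop D (proj₂ found) (s≤s (s≤s (s≤s z≤n)))
    where
    found = zigzag x a x a<x x<πa πa<πx (λ _ x<v _ → x<v) (z , x<z , r) (>-wellFounded _)

  topFree⇒valid : ¬ HasTopCycle D → Valid D
  topFree⇒valid ¬top = record { unique = uniq ; last = last }
    where
    uniq : ∀ {a x z} → RightOf D a x → RightOf D a z → x ≡ z
    uniq {x = x} {z} p q with Fin.<-cmp x z
    ... | tri< lt _ _ = ⊥-elim (¬top (two-rightOf⇒top p q lt))
    ... | tri≈ _ e _  = e
    ... | tri> _ _ gt = ⊥-elim (¬top (two-rightOf⇒top q p gt))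

-- Equality of the two classes and their cardinality

module _ {n} {D : ChordDiagram n} where

  valid : OneTerminalTopCycleFree D → Valid D
  valid (one , ¬top) = topFree⇒valid D (oneTerminal⇒lastIfTerminal one) ¬top

  -- The point 0 is a source in every diagram, so the run condition is automatic at `g = 0`.
  topCycleFree⇒validUpTo₀ : OneTerminalTopCycleFree D → ValidUpTo D 0
  topCycleFree⇒validUpTo₀ p = valid p , λ x q → source-zero D x (n≤0⇒n≡0 q)

  validUpTo₀⇒topCycleFree : ValidUpTo D 0 → OneTerminalTopCycleFree D
  validUpTo₀⇒topCycleFree (V , _) = lastIfTerminal⇒oneTerminal (Valid.last V) , valid⇒¬top V

theorem7p12 : ∀ (n : ℕ) → 1 ≤ n →
    (OneTerminalTopCycleFree {n} ≐ OneTerminalCycleFree {n}) ×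
    HasCardinality (OneTerminalTopCycleFree {n}) (catalan (n ∸ 1))
theorem7p12 (suc n) 1≤n =
  ((λ p → proj₁ p , proj₂ p , valid⇒¬bottom (valid p)) , (λ (one , ¬top , _) → one , ¬top)) ,
  subst (HasCardinality _) (ballot≡catalan n) (enumeration⇒hasCardinality
    (enumeration-≐ ((λ {D} → validUpTo₀⇒topCycleFree {D = D}) ,
                    (λ {D} → topCycleFree⇒validUpTo₀ {D = D}))
      (enumeration (suc n) 0 (suc n) refl 1≤n)))
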